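{- Let $G$ be a finite simple graph with an edge $e=\{x,y\}\in E(G)$ such that $\deg(x)\le 2$ and $\deg(y)\le 2$. Then $M_2(G)$ is contractible.
   Context: A $2$-matching of a graph $G$ is a set of edges $H\subseteq E(G)$ such that every vertex has degree at most $2$ in $H$. The $2$-matching complex $M_2(G)$ is the simplicial complex whose vertices are the edges of $G$ and whose faces are the $2$-matchings of $G$. -}

module Defs where

open import Level using (0ℓ)
open import Data.Fin.Base using (Fin)
import Data.Fin.Subset as Subset
open import Data.Fin.Subset using (Subset; ⁅_⁆; _∩_; _∉_; _⊆_)
import Data.Fin.Subset.Properties as Subsetₚ
open import Data.Nat.Base as ℕ using (ℕ; _⊔_)
import Data.Nat.Properties as ℕₚ
open import Data.Product using (∃; _×_; _,_; proj₁; proj₂)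
open import Data.Product.Relation.Binary.Pointwise.NonDependent using (×-isEquivalence)
open import Data.Rational as ℚ using (ℚ; 0ℚ; 1ℚ; ½)
import Data.Rational.Properties as ℚₚ
open import Data.Rational.Solver using (module +-*-Solver)
open import Data.Sum using (inj₁; inj₂)
open import Data.Vec.Base using (tabulate; lookup)
import Data.Vec.Functional as Functional
open import Function.Base using (_∘_; _on_)
open import Function.Definitions using (Injective)
import Relation.Binary.Construct.On as On
open import Relation.Binary.Core using (Rel)
open import Relation.Binary.Structures using (IsEquivalence)
open import Relation.Binary.PropositionalEquality
  using (_≡_; refl; sym; trans; cong; subst; subst₂)
open import Relation.Unary using (Pred; U; ⋃; _≐_; _⟨×⟩_) renaming (_∩_ to _∩ᵖ_; _⊆_ to _⊆ᵖ_)

private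
  dist : ℚ → ℚ → ℚ
  dist p q = ℚ.∣ p ℚ.- q ∣

  abstract
    half-pos : ∀ {ε} → 0ℚ ℚ.< ε → 0ℚ ℚ.< ½ ℚ.* ε
    half-pos {ε} 0<ε = subst (ℚ._< ½ ℚ.* ε) (ℚₚ.*-zeroʳ ½) (ℚₚ.*-monoʳ-<-pos ½ 0<ε)

    half+half : ∀ ε → ½ ℚ.* ε ℚ.+ ½ ℚ.* ε ≡ ε
    half+half ε = trans (sym (ℚₚ.*-distribʳ-+ ε ½ ½)) (ℚₚ.*-identityˡ ε)

    dist-refl : ∀ p → dist p p ≡ 0ℚ
    dist-refl p = cong ℚ.∣_∣ (ℚₚ.+-inverseʳ p)

    dist-sym : ∀ p q → dist p q ≡ dist q p
    dist-sym p q = trans (sym (ℚₚ.∣-p∣≡∣p∣ (p ℚ.- q)))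
      (cong ℚ.∣_∣ (solve 2 (λ a b → :- (a :- b) := b :- a) refl p q))
      where open +-*-Solver

    dist-triangle : ∀ p q r → dist p r ℚ.≤ dist p q ℚ.+ dist q r
    dist-triangle p q r = subst (ℚ._≤ dist p q ℚ.+ dist q r)
      (cong ℚ.∣_∣ (solve 3 (λ a b c → (a :- b) :+ (b :- c) := a :- c) refl p q r))
      (ℚₚ.∣p+q∣≤∣p∣+∣q∣ (p ℚ.- q) (q ℚ.- r))
      where open +-*-Solver

    dist-+ : ∀ p q r s → dist (p ℚ.+ q) (r ℚ.+ s) ℚ.≤ dist p r ℚ.+ dist q s
    dist-+ p q r s = subst (ℚ._≤ dist p r ℚ.+ dist q s)
      (cong ℚ.∣_∣ (solve 4 (λ a b c d → (a :- c) :+ (b :- d) := (a :+ b) :- (c :+ d)) refl p q r s))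
      (ℚₚ.∣p+q∣≤∣p∣+∣q∣ (p ℚ.- r) (q ℚ.- s))
      where open +-*-Solver

    dist-neg : ∀ p q → dist (ℚ.- p) (ℚ.- q) ≡ dist p q
    dist-neg p q = trans
      (cong ℚ.∣_∣ (solve 2 (λ a b → (:- a) :- (:- b) := :- (a :- b)) refl p q))
      (ℚₚ.∣-p∣≡∣p∣ (p ℚ.- q))
      where open +-*-Solver

    ∣p∣-∣q∣≤dist : ∀ p q → ℚ.∣ p ∣ ℚ.- ℚ.∣ q ∣ ℚ.≤ dist p q
    ∣p∣-∣q∣≤dist p q = subst₂ ℚ._≤_
      refl
      (solve 2 (λ d b → (d :+ b) :- b := d) refl (dist p q) ℚ.∣ q ∣)
      (ℚₚ.+-monoˡ-≤ (ℚ.- ℚ.∣ q ∣)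
        (subst (λ z → ℚ.∣ z ∣ ℚ.≤ dist p q ℚ.+ ℚ.∣ q ∣)
          (solve 2 (λ a b → (a :- b) :+ b := a) refl p q)
          (ℚₚ.∣p+q∣≤∣p∣+∣q∣ (p ℚ.- q) q)))
      where open +-*-Solver

    dist-∣∣ : ∀ p q → dist ℚ.∣ p ∣ ℚ.∣ q ∣ ℚ.≤ dist p q
    dist-∣∣ p q with ℚₚ.∣p∣≡p∨∣p∣≡-p (ℚ.∣ p ∣ ℚ.- ℚ.∣ q ∣)
    ... | inj₁ eq = subst (ℚ._≤ dist p q) (sym eq) (∣p∣-∣q∣≤dist p q)
    ... | inj₂ eq = subst₂ ℚ._≤_
      (trans (solve 2 (λ a b → b :- a := :- (a :- b)) refl ℚ.∣ p ∣ ℚ.∣ q ∣) (sym eq))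
      (dist-sym q p)
      (∣p∣-∣q∣≤dist q p)
      where open +-*-Solver

    sum-halves : ∀ {a b c ε} → a ℚ.≤ b ℚ.+ c →
                 b ℚ.< ½ ℚ.* ε → c ℚ.< ½ ℚ.* ε → a ℚ.< ε
    sum-halves {ε = ε} a≤b+c b<ε/2 c<ε/2 = ℚₚ.≤-<-trans a≤b+c
      (subst (_ ℚ.<_) (half+half ε) (ℚₚ.+-mono-< b<ε/2 c<ε/2))

Eventually : Pred ℕ 0ℓ → Set
Eventually P = ∃ λ N → ∀ n → N ℕ.≤ n → P n

private
  eventually₂ : ∀ {P Q R : Pred ℕ 0ℓ} → (∀ n → P n → Q n → R n) →
                Eventually P → Eventually Q → Eventually R
  eventually₂ f (M , p) (N , q) = M ⊔ N , λ n M⊔N≤n →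
    f n (p n (ℕₚ.m⊔n≤o⇒m≤o M N M⊔N≤n)) (q n (ℕₚ.m⊔n≤o⇒n≤o M N M⊔N≤n))

-- A real number is a Cauchy sequence of rationals; equality of reals is _≈ᴿ_.
record ℝ : Set where
  constructor mkℝ
  field
    seq    : ℕ → ℚ
    cauchy : ∀ ε → 0ℚ ℚ.< ε → ∃ λ N → ∀ m n → N ℕ.≤ m → N ℕ.≤ n →
             ℚ.∣ seq m ℚ.- seq n ∣ ℚ.< ε
open ℝ public

infix 4 _≈ᴿ_ _<ᴿ_ _≤ᴿ_
infixl 6 _+ᴿ_ _-ᴿ_
infix 8 -ᴿ_

_≈ᴿ_ _<ᴿ_ _≤ᴿ_ : Rel ℝ 0ℓ
x ≈ᴿ y = ∀ ε → 0ℚ ℚ.< ε → Eventually λ n → ℚ.∣ seq x n ℚ.- seq y n ∣ ℚ.< ε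
x <ᴿ y = ∃ λ ε → 0ℚ ℚ.< ε × Eventually λ n → seq x n ℚ.+ ε ℚ.≤ seq y n
x ≤ᴿ y = ∀ ε → 0ℚ ℚ.< ε → Eventually λ n → seq x n ℚ.≤ seq y n ℚ.+ ε

fromℚ : ℚ → ℝ
fromℚ q = mkℝ (λ _ → q) λ ε 0<ε → 0 , λ _ _ _ _ → subst (ℚ._< ε) (sym (dist-refl q)) 0<ε

0ᴿ 1ᴿ : ℝ
0ᴿ = fromℚ 0ℚ
1ᴿ = fromℚ 1ℚ

_+ᴿ_ : ℝ → ℝ → ℝ
x +ᴿ y = mkℝ (λ n → seq x n ℚ.+ seq y n) λ ε 0<ε →
  let M , p = cauchy x (½ ℚ.* ε) (half-pos 0<ε)
      N , q = cauchy y (½ ℚ.* ε) (half-pos 0<ε)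
  in M ⊔ N , λ m n ≤m ≤n → sum-halves
       (dist-+ (seq x m) (seq y m) (seq x n) (seq y n))
       (p m n (ℕₚ.m⊔n≤o⇒m≤o M N ≤m) (ℕₚ.m⊔n≤o⇒m≤o M N ≤n))
       (q m n (ℕₚ.m⊔n≤o⇒n≤o M N ≤m) (ℕₚ.m⊔n≤o⇒n≤o M N ≤n))

-ᴿ_ : ℝ → ℝ
-ᴿ x = mkℝ (λ n → ℚ.- seq x n) λ ε 0<ε →
  let N , p = cauchy x ε 0<ε
  in N , λ m n ≤m ≤n → subst (ℚ._< ε) (sym (dist-neg (seq x m) (seq x n))) (p m n ≤m ≤n)

_-ᴿ_ : ℝ → ℝ → ℝ
x -ᴿ y = x +ᴿ (-ᴿ y)

∣_∣ᴿ : ℝ → ℝ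
∣ x ∣ᴿ = mkℝ (λ n → ℚ.∣ seq x n ∣) λ ε 0<ε →
  let N , p = cauchy x ε 0<ε
  in N , λ m n ≤m ≤n → ℚₚ.≤-<-trans (dist-∣∣ (seq x m) (seq x n)) (p m n ≤m ≤n)

sumᴿ : ∀ {n} → (Fin n → ℝ) → ℝ
sumᴿ = Functional.foldr _+ᴿ_ 0ᴿ

≈ᴿ-isEquivalence : IsEquivalence _≈ᴿ_
≈ᴿ-isEquivalence = record
  { refl  = λ {x} ε 0<ε → 0 , λ n _ → subst (ℚ._< ε) (sym (dist-refl (seq x n))) 0<ε
  ; sym   = λ {x} {y} x≈y ε 0<ε →
      let N , p = x≈y ε 0<ε
      in N , λ n ≤n → subst (ℚ._< ε) (dist-sym (seq x n) (seq y n)) (p n ≤n)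
  ; trans = λ {x} {y} {z} x≈y y≈z ε 0<ε → eventually₂
      (λ n → sum-halves (dist-triangle (seq x n) (seq y n) (seq z n)))
      (x≈y (½ ℚ.* ε) (half-pos 0<ε)) (y≈z (½ ℚ.* ε) (half-pos 0<ε))
  }

-- The points form a setoid.  Unions are over families indexed by a Set;
-- the empty family shows that the empty set is open.
record Space : Set₂ where
  field
    Point         : Set
    _≈_           : Rel Point 0ℓ
    isEquivalence : IsEquivalence _≈_
    Open          : Pred Point 0ℓ → Set₁
    Open-resp-≈   : ∀ {V} → Open V → ∀ {x y} → x ≈ y → V x → V y
    Open-resp-≐   : ∀ {V W} → V ≐ W → Open V → Open W
    Open-U        : Open U
    Open-∩        : ∀ {V W} → Open V → Open W → Open (V ∩ᵖ W)
    Open-⋃        : ∀ (I : Set) (V : I → Pred Point 0ℓ) → (∀ i → Open (V i)) → Open (⋃ I V)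

module _ (X Y : Space) where
  private
    module X = Space X
    module Y = Space Y

  record ContinuousMap : Set₁ where
    field
      to         : X.Point → Y.Point
      to-cong    : ∀ {x x′} → x X.≈ x′ → to x Y.≈ to x′
      continuous : ∀ {V} → Y.Open V → X.Open (V ∘ to)

  record ProductOpen (W : Pred (X.Point × Y.Point) 0ℓ) : Set₁ where
    field
      box : ∀ {x y} → W (x , y) → ∃ λ V₁ → ∃ λ V₂ →
            X.Open V₁ × Y.Open V₂ × V₁ x × V₂ y × (V₁ ⟨×⟩ V₂) ⊆ᵖ W

  infixr 2 _×ˢ_
  _×ˢ_ : Space
  _×ˢ_ = record
    { Point         = X.Point × Y.Point
    ; _≈_           = λ p q → (proj₁ p X.≈ proj₁ q) × (proj₂ p Y.≈ proj₂ q)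
    ; isEquivalence = ×-isEquivalence X.isEquivalence Y.isEquivalence
    ; Open          = ProductOpen
    ; Open-resp-≈   = λ o (x≈ , y≈) w →
        let _ , _ , o₁ , o₂ , v₁ , v₂ , sub = ProductOpen.box o w
        in sub (X.Open-resp-≈ o₁ x≈ v₁ , Y.Open-resp-≈ o₂ y≈ v₂)
    ; Open-resp-≐   = λ (V⊆W , W⊆V) o → record { box = λ w →
        let V₁ , V₂ , o₁ , o₂ , v₁ , v₂ , sub = ProductOpen.box o (W⊆V w)
        in V₁ , V₂ , o₁ , o₂ , v₁ , v₂ , λ v → V⊆W (sub v) }
    ; Open-U        = record { box = λ _ → U , U , X.Open-U , Y.Open-U , _ , _ , _ }
    ; Open-∩        = λ o o′ → record { box = λ (w , w′) →
        let V₁ , V₂ , o₁ , o₂ , v₁ , v₂ , sub  = ProductOpen.box o w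
            W₁ , W₂ , p₁ , p₂ , w₁ , w₂ , sub′ = ProductOpen.box o′ w′
        in V₁ ∩ᵖ W₁ , V₂ ∩ᵖ W₂ , X.Open-∩ o₁ p₁ , Y.Open-∩ o₂ p₂ , (v₁ , w₁) , (v₂ , w₂) ,
           λ ((a , a′) , (b , b′)) → sub (a , b) , sub′ (a′ , b′) }
    ; Open-⋃        = λ I V o → record { box = λ (i , w) →
        let V₁ , V₂ , o₁ , o₂ , v₁ , v₂ , sub = ProductOpen.box (o i) w
        in V₁ , V₂ , o₁ , o₂ , v₁ , v₂ , λ v → i , sub v }
    }

module _ (X : Space) (n : ℕ) where
  private module X = Space X

  record PowerOpen (W : Pred (Fin n → X.Point) 0ℓ) : Set₁ where
    field
      box : ∀ {x} → W x → ∃ λ (V : Fin n → Pred X.Point 0ℓ) →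
            (∀ i → X.Open (V i)) × (∀ i → V i (x i)) × (∀ {y} → (∀ i → V i (y i)) → W y)

  Power : Space
  Power = record
    { Point         = Fin n → X.Point
    ; _≈_           = λ x y → ∀ i → x i X.≈ y i
    ; isEquivalence = record
        { refl  = λ _ → ≈.refl
        ; sym   = λ x≈y i → ≈.sym (x≈y i)
        ; trans = λ x≈y y≈z i → ≈.trans (x≈y i) (y≈z i)
        }
    ; Open          = PowerOpen
    ; Open-resp-≈   = λ o x≈y w →
        let _ , oᵥ , v , sub = PowerOpen.box o w
        in sub λ i → X.Open-resp-≈ (oᵥ i) (x≈y i) (v i)
    ; Open-resp-≐   = λ (V⊆W , W⊆V) o → record { box = λ w →
        let V , oᵥ , v , sub = PowerOpen.box o (W⊆V w)
        in V , oᵥ , v , λ u → V⊆W (sub u) }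
    ; Open-U        = record { box = λ _ → (λ _ → U) , (λ _ → X.Open-U) , _ , _ }
    ; Open-∩        = λ o o′ → record { box = λ (w , w′) →
        let V , oᵥ , v , sub  = PowerOpen.box o w
            T , oₜ , t , sub′ = PowerOpen.box o′ w′
        in (λ i → V i ∩ᵖ T i) , (λ i → X.Open-∩ (oᵥ i) (oₜ i)) , (λ i → v i , t i) ,
           λ u → sub (λ i → proj₁ (u i)) , sub′ (λ i → proj₂ (u i)) }
    ; Open-⋃        = λ I W o → record { box = λ (j , w) →
        let V , oᵥ , v , sub = PowerOpen.box (o j) w
        in V , oᵥ , v , λ u → j , sub u }
    }
    where module ≈ = IsEquivalence X.isEquivalence

-- The subspace of X whose points are the elements of S, included by ι.
Subspace : (X : Space) {S : Set} → (S → Space.Point X) → Space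
Subspace X {S} ι = record
  { Point         = S
  ; _≈_           = X._≈_ on ι
  ; isEquivalence = On.isEquivalence ι X.isEquivalence
  ; Open          = λ V → ∃ λ W → X.Open W × V ≐ (W ∘ ι)
  ; Open-resp-≈   = λ (_ , o , V⊆W , W⊆V) x≈y v → W⊆V (X.Open-resp-≈ o x≈y (V⊆W v))
  ; Open-resp-≐   = λ (V⊆V′ , V′⊆V) (W , o , V⊆W , W⊆V) →
      W , o , (λ v → V⊆W (V′⊆V v)) , (λ w → V⊆V′ (W⊆V w))
  ; Open-U        = U , X.Open-U , (λ _ → _) , (λ _ → _)
  ; Open-∩        = λ (W , o , V⊆W , W⊆V) (W′ , o′ , V′⊆W′ , W′⊆V′) →
      W ∩ᵖ W′ , X.Open-∩ o o′ ,
      (λ (v , v′) → V⊆W v , V′⊆W′ v′) , (λ (w , w′) → W⊆V w , W′⊆V′ w′)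
  ; Open-⋃        = λ I V o →
      ⋃ I (λ i → proj₁ (o i)) , X.Open-⋃ I _ (λ i → proj₁ (proj₂ (o i))) ,
      (λ (i , v) → i , proj₁ (proj₂ (proj₂ (o i))) v) ,
      (λ (i , w) → i , proj₂ (proj₂ (proj₂ (o i))) w)
  }
  where module X = Space X

record RealOpen (V : Pred ℝ 0ℓ) : Set₁ where
  field
    ball : ∀ {x} → V x → ∃ λ ε → 0ℚ ℚ.< ε ×
           (∀ {y} → ∣ y -ᴿ x ∣ᴿ <ᴿ fromℚ ε → V y)

private
  abstract
    ≈ᴿ⇒near : ∀ x y → x ≈ᴿ y → ∀ ε → 0ℚ ℚ.< ε → ∣ y -ᴿ x ∣ᴿ <ᴿ fromℚ ε
    ≈ᴿ⇒near x y x≈y ε 0<ε =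
      let N , p = x≈y (½ ℚ.* ε) (half-pos 0<ε)
      in ½ ℚ.* ε , half-pos 0<ε , N , λ n ≤n →
         subst₂ ℚ._≤_ (cong (ℚ._+ ½ ℚ.* ε) (dist-sym (seq x n) (seq y n))) (half+half ε)
           (ℚₚ.+-monoˡ-≤ (½ ℚ.* ε) (ℚₚ.<⇒≤ (p n ≤n)))

    near-⊓ˡ : ∀ {x : ℝ} ε δ → x <ᴿ fromℚ (ε ℚ.⊓ δ) → x <ᴿ fromℚ ε
    near-⊓ˡ ε δ (η , 0<η , N , p) = η , 0<η , N , λ n ≤n → ℚₚ.≤-trans (p n ≤n) (ℚₚ.p⊓q≤p ε δ)

    near-⊓ʳ : ∀ {x : ℝ} ε δ → x <ᴿ fromℚ (ε ℚ.⊓ δ) → x <ᴿ fromℚ δ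
    near-⊓ʳ ε δ (η , 0<η , N , p) = η , 0<η , N , λ n ≤n → ℚₚ.≤-trans (p n ≤n) (ℚₚ.p⊓q≤q ε δ)

    ⊓-pos : ∀ {ε δ} → 0ℚ ℚ.< ε → 0ℚ ℚ.< δ → 0ℚ ℚ.< ε ℚ.⊓ δ
    ⊓-pos {ε} {δ} 0<ε 0<δ with ℚₚ.⊓-sel ε δ
    ... | inj₁ eq = subst (0ℚ ℚ.<_) (sym eq) 0<ε
    ... | inj₂ eq = subst (0ℚ ℚ.<_) (sym eq) 0<δ

RealLine : Space
RealLine = record
  { Point         = ℝ
  ; _≈_           = _≈ᴿ_
  ; isEquivalence = ≈ᴿ-isEquivalence
  ; Open          = RealOpen
  ; Open-resp-≈   = λ o {x} {y} x≈y v →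
      let ε , 0<ε , sub = RealOpen.ball o v
      in sub (≈ᴿ⇒near x y x≈y ε 0<ε)
  ; Open-resp-≐   = λ (V⊆W , W⊆V) o → record { ball = λ w →
      let ε , 0<ε , sub = RealOpen.ball o (W⊆V w)
      in ε , 0<ε , λ near → V⊆W (sub near) }
  ; Open-U        = record { ball = λ _ → 1ℚ , ℚₚ.positive⁻¹ 1ℚ , _ }
  ; Open-∩        = λ o o′ → record { ball = λ {x} (v , w) →
      let ε , 0<ε , sub  = RealOpen.ball o v
          δ , 0<δ , sub′ = RealOpen.ball o′ w
      in ε ℚ.⊓ δ , ⊓-pos 0<ε 0<δ , λ {y} near →
         sub (near-⊓ˡ {∣ y -ᴿ x ∣ᴿ} ε δ near) , sub′ (near-⊓ʳ {∣ y -ᴿ x ∣ᴿ} ε δ near) }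
  ; Open-⋃        = λ I V o → record { ball = λ (i , v) →
      let ε , 0<ε , sub = RealOpen.ball (o i) v
      in ε , 0<ε , λ near → i , sub near }
  }

record UnitIntervalPoint : Set where
  field
    value : ℝ
    0≤    : 0ᴿ ≤ᴿ value
    ≤1    : value ≤ᴿ 1ᴿ

UnitInterval : Space
UnitInterval = Subspace RealLine UnitIntervalPoint.value

private
  abstract
    ≤ᴿ-const : ∀ {p q} → p ℚ.≤ q → fromℚ p ≤ᴿ fromℚ q
    ≤ᴿ-const {p} {q} p≤q ε 0<ε = 0 , λ _ _ →
      subst (ℚ._≤ q ℚ.+ ε) (ℚₚ.+-identityʳ p) (ℚₚ.+-mono-≤ p≤q (ℚₚ.<⇒≤ 0<ε))

    0≤1 : 0ℚ ℚ.≤ 1ℚ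
    0≤1 = ℚₚ.nonNegative⁻¹ 1ℚ

0ᴵ 1ᴵ : UnitIntervalPoint
0ᴵ = record { value = 0ᴿ ; 0≤ = ≤ᴿ-const ℚₚ.≤-refl ; ≤1 = ≤ᴿ-const 0≤1 }
1ᴵ = record { value = 1ᴿ ; 0≤ = ≤ᴿ-const 0≤1 ; ≤1 = ≤ᴿ-const ℚₚ.≤-refl }

identity : (X : Space) → ContinuousMap X X
identity X = record { to = λ x → x ; to-cong = λ x≈y → x≈y ; continuous = λ o → o }

-- The preimage of V is the union, indexed by the proofs of V y, of the whole space.
constant : (X Y : Space) → Space.Point Y → ContinuousMap X Y
constant X Y y = record
  { to         = λ _ → y
  ; to-cong    = λ _ → IsEquivalence.refl (Space.isEquivalence Y)
  ; continuous = λ {V} _ → Space.Open-resp-≐ X (proj₁ , λ v → v , _)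
      (Space.Open-⋃ X (V y) (λ _ → U) (λ _ → Space.Open-U X))
  }

record Homotopy {X Y : Space} (f g : ContinuousMap X Y) : Set₁ where
  open ContinuousMap
  open Space Y using (_≈_)
  field
    map     : ContinuousMap (UnitInterval ×ˢ X) Y
    map-at0 : ∀ x → to map (0ᴵ , x) ≈ to f x
    map-at1 : ∀ x → to map (1ᴵ , x) ≈ to g x

Contractible : Space → Set₁
Contractible X = ∃ λ (p : Space.Point X) → Homotopy {X} {X} (identity X) (constant X X p)

-- An abstract simplicial complex with vertex set Fin n.
record SimplicialComplex (n : ℕ) : Set₁ where
  field
    Face        : Pred (Subset n) 0ℓ
    Face-vertex : ∀ v → Face ⁅ v ⁆
    Face-⊆      : ∀ {σ τ} → σ ⊆ τ → Face τ → Face σ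

-- A point of the geometric realization, in barycentric coordinates.
record RealizationPoint {n} (K : SimplicialComplex n) : Set where
  open SimplicialComplex K
  field
    coord     : Fin n → ℝ
    coord-≥0  : ∀ v → 0ᴿ ≤ᴿ coord v
    coord-sum : sumᴿ coord ≈ᴿ 1ᴿ
    carrier   : ∃ λ σ → Face σ × (∀ v → v ∉ σ → coord v ≈ᴿ 0ᴿ)

-- K is finite, so its realization carries the subspace topology of ℝⁿ.
∣_∣ : ∀ {n} → SimplicialComplex n → Space
∣_∣ {n} K = Subspace (Power RealLine n) (RealizationPoint.coord {K = K})

-- The vertex set is Fin #V, and the edge set is a set of #E two-element
-- subsets of it, enumerated without repetition by ends.
record SimpleGraph : Set where
  field
    #V #E          : ℕ
    ends           : Fin #E → Subset #V
    ends-size      : ∀ e → Subset.∣ ends e ∣ ≡ 2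
    ends-injective : Injective _≡_ _≡_ ends

  Vertex Edge EdgeSet : Set
  Vertex  = Fin #V
  Edge    = Fin #E
  EdgeSet = Subset #E

  incident : Vertex → EdgeSet
  incident v = tabulate λ e → lookup (ends e) v

  degreeIn : EdgeSet → Vertex → ℕ
  degreeIn H v = Subset.∣ H ∩ incident v ∣

  degree : Vertex → ℕ
  degree = degreeIn Subset.⊤

  Is2Matching : Pred EdgeSet 0ℓ
  Is2Matching H = ∀ v → degreeIn H v ℕ.≤ 2

M₂ : (G : SimpleGraph) → SimplicialComplex (SimpleGraph.#E G)
M₂ G = record
  { Face        = Is2Matching
  ; Face-vertex = λ e v → ℕₚ.≤-trans (Subsetₚ.∣p∩q∣≤∣p∣ ⁅ e ⁆ (incident v))
      (ℕₚ.≤-trans (ℕₚ.≤-reflexive (Subsetₚ.∣⁅x⁆∣≡1 e)) (ℕₚ.n≤1+n 1))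
  ; Face-⊆      = λ {σ} {τ} σ⊆τ m v → ℕₚ.≤-trans
      (Subsetₚ.p⊆q⇒∣p∣≤∣q∣ λ x∈ →
        let x∈σ , x∈v = Subsetₚ.x∈p∩q⁻ σ (incident v) x∈
        in Subsetₚ.x∈p∩q⁺ (σ⊆τ x∈σ , x∈v))
      (m v)
  }
  where open SimpleGraph G

{-# OPTIONS --safe #-}
module Submission where

-- Adding e to a 2-matching keeps every degree at most 2: at x and y because G itself has
-- at most two edges there, elsewhere because e is not incident.  So M₂ G is a cone with
-- apex e, and it contracts by moving all barycentric mass to e.
-- Coordinates are combined by uniformly continuous functions on ℚᵐ, applied term by term
-- to Cauchy sequences.  Replacing non-negative reals by their absolute values makes their
-- terms non-negative, which turns facts about reals into facts about rationals.

open import Defs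
open import Data.Nat.Base using (_≤_)
open import Data.Fin.Subset using (⁅_⁆; _∪_)
open import Relation.Binary.PropositionalEquality using (_≡_)

open import Data.Empty using (⊥-elim)
open import Data.Fin.Base using (Fin; zero; suc)
open import Data.Fin.Subset using (_∈_; _⊆_; _∩_)
import Data.Fin.Subset.Properties as Subsetₚ
open import Data.Nat.Base using (ℕ; zero; suc; _⊔_)
import Data.Nat.Properties as ℕₚ
open import Data.Product using (∃; _,_; proj₁; proj₂)
open import Data.Rational as ℚ using (ℚ; 0ℚ; 1ℚ; ½; _+_; _-_; -_; _*_; _⊓_; _<_)
import Data.Rational.Properties as ℚₚ
open import Data.Rational.Solver using (module +-*-Solver)
open import Data.Sum using (inj₁; inj₂; [_,_]′)
import Data.Vec.Properties as Vecₚ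
open import Data.Vec.Functional using (Vector; _∷_; updateAt)
open import Data.Vec.Functional.Properties using (updateAt-minimal)
open import Function.Base using (_∘_; const)
open import Level using (0ℓ)
open import Relation.Binary.PropositionalEquality
  using (refl; sym; trans; cong; cong₂; subst; _≢_; module ≡-Reasoning)
open import Relation.Binary.Bundles using (Setoid)
import Relation.Binary.Reasoning.Setoid
open import Relation.Binary.Structures using (IsEquivalence)
open import Relation.Nullary using (yes; no)
open import Relation.Unary using (Pred)

open import Algebra.Properties.CommutativeMonoid.Sum ℚₚ.+-0-commutativeMonoid
  using (sum; sum-cong-≗; ∑-distrib-+)
open IsEquivalence ≈ᴿ-isEquivalence using () renaming (refl to ≈ᴿ-refl; sym to ≈ᴿ-sym)

ℝ-setoid : Setoid 0ℓ 0ℓ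
ℝ-setoid = record { isEquivalence = ≈ᴿ-isEquivalence }

module ≈ᴿ-Reasoning = Relation.Binary.Reasoning.Setoid ℝ-setoid

private
  variable
    m n : ℕ

-- Uniform choices over finite index sets

-- Finitely many witnesses are merged by `_∙_`, which each `P v` survives on either side; `ε` starts
-- the recursion. With `_⊔_` this gives a common index, with `_⊓⁺_` a common radius.
common-witness : {A : Set} (_∙_ : A → A → A) (ε : A) {P : Fin n → A → Set} →
  (∀ {v a b} → P v a → P v (a ∙ b)) → (∀ {v a b} → P v b → P v (a ∙ b)) →
  (∀ v → ∃ (P v)) → ∃ λ a → ∀ v → P v a
common-witness {zero}  _∙_ ε weakenˡ weakenʳ h = ε , λ ()
common-witness {suc n} _∙_ ε weakenˡ weakenʳ h =
  let a , p  = h zero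
      b , ps = common-witness _∙_ ε weakenˡ weakenʳ (h ∘ suc)
  in a ∙ b , λ { zero → weakenˡ p ; (suc v) → weakenʳ (ps v) }

eventually-∀ : {P : Fin n → Pred ℕ 0ℓ} →
  (∀ v → Eventually (P v)) → Eventually λ k → ∀ v → P v k
eventually-∀ h =
  let N , p = common-witness _⊔_ 0
        (λ {_} {M} {N} p k ≤k → p k (ℕₚ.m⊔n≤o⇒m≤o M N ≤k))
        (λ {_} {M} {N} p k ≤k → p k (ℕₚ.m⊔n≤o⇒n≤o M N ≤k)) h
  in N , λ k ≤k v → p v k ≤k

eventually-map : {P Q : Pred ℕ 0ℓ} → (∀ k → P k → Q k) → Eventually P → Eventually Q
eventually-map f (N , p) = N , λ k ≤k → f k (p k ≤k)

-- Positive rationals and the distance on ℚ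

-- Carrying the positivity proof along makes the radii a type closed under minima, as
-- `common-witness` requires.
ℚ⁺ : Set
ℚ⁺ = ∃ (0ℚ <_)

_⊓⁺_ : ℚ⁺ → ℚ⁺ → ℚ⁺
(δ , 0<δ) ⊓⁺ (ε , 0<ε) = δ ⊓ ε ,
  [ (λ eq → subst (0ℚ <_) (sym eq) 0<δ) , (λ eq → subst (0ℚ <_) (sym eq) 0<ε) ]′ (ℚₚ.⊓-sel δ ε)

1⁺ : ℚ⁺
1⁺ = 1ℚ , ℚₚ.positive⁻¹ 1ℚ

half⁺ : ∀ {ε} → 0ℚ < ε → 0ℚ < ½ * ε
half⁺ {ε} 0<ε = subst (_< ½ * ε) (ℚₚ.*-zeroʳ ½) (ℚₚ.*-monoʳ-<-pos ½ 0<ε)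

half+half≡ : ∀ ε → ½ * ε + ½ * ε ≡ ε
half+half≡ ε = trans (sym (ℚₚ.*-distribʳ-+ ε ½ ½)) (ℚₚ.*-identityˡ ε)

p<p+ε : ∀ p {ε} → 0ℚ < ε → p < p + ε
p<p+ε p 0<ε = subst (_< p + _) (ℚₚ.+-identityʳ p) (ℚₚ.+-monoʳ-< p 0<ε)

p≤∣p∣ : ∀ p → p ℚ.≤ ℚ.∣ p ∣
p≤∣p∣ p with ℚₚ.≤-total 0ℚ p
... | inj₁ 0≤p = ℚₚ.≤-reflexive (sym (ℚₚ.0≤p⇒∣p∣≡p 0≤p))
... | inj₂ p≤0 = ℚₚ.≤-trans p≤0 (ℚₚ.0≤∣p∣ p)

dist : ℚ → ℚ → ℚ
dist p q = ℚ.∣ p - q ∣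

dist-comm : ∀ p q → dist p q ≡ dist q p
dist-comm p q = trans (sym (ℚₚ.∣-p∣≡∣p∣ (p - q)))
  (cong ℚ.∣_∣ (solve 2 (λ a b → :- (a :- b) := b :- a) refl p q))
  where open +-*-Solver

dist-self : ∀ p → dist p p ≡ 0ℚ
dist-self p = cong ℚ.∣_∣ (ℚₚ.+-inverseʳ p)

dist-through : ∀ p q r → dist p r ℚ.≤ dist p q + dist q r
dist-through p q r = subst (ℚ._≤ dist p q + dist q r)
  (cong ℚ.∣_∣ (solve 3 (λ a b c → (a :- b) :+ (b :- c) := a :- c) refl p q r))
  (ℚₚ.∣p+q∣≤∣p∣+∣q∣ (p - q) (q - r))
  where open +-*-Solver

dist<⇒< : ∀ {p q ε} → dist p q < ε → p < q + ε
dist<⇒< {p} {q} {ε} d<ε = subst (_< q + ε)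
  (solve 2 (λ a b → b :+ (a :- b) := a) refl p q)
  (ℚₚ.+-monoʳ-< q (ℚₚ.≤-<-trans (p≤∣p∣ (p - q)) d<ε))
  where open +-*-Solver

<⇒-< : ∀ {p q ε} → p < q + ε → p - q < ε
<⇒-< {p} {q} {ε} p<q+ε = subst (p - q <_)
  (solve 2 (λ a b → (a :+ b) :- a := b) refl q ε)
  (ℚₚ.+-monoˡ-< (- q) p<q+ε)
  where open +-*-Solver

<⇒dist< : ∀ {p q ε} → p < q + ε → q < p + ε → dist p q < ε
<⇒dist< {p} {q} {ε} p<q+ε q<p+ε with ℚₚ.∣p∣≡p∨∣p∣≡-p (p - q)
... | inj₁ eq = subst (_< ε) (sym eq) (<⇒-< p<q+ε)
... | inj₂ eq = subst (_< ε)
  (trans (solve 2 (λ a b → b :- a := :- (a :- b)) refl p q) (sym eq)) (<⇒-< q<p+ε)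
  where open +-*-Solver

-- Uniformly continuous functions of rational vectors

-- Continuity for the sup distance. The modulus is independent of the point, so one `δ` serves all
-- terms of a sequence at once.
record UniformlyContinuous (f : Vector ℚ m → ℚ) : Set where
  constructor mkUniform
  field
    modulus : ∀ ε → 0ℚ < ε → ∃ λ ((δ , _) : ℚ⁺) →
      ∀ a b → (∀ i → dist (a i) (b i) < δ) → dist (f a) (f b) < ε
open UniformlyContinuous

record UniformlyContinuous₂ (_∙_ : ℚ → ℚ → ℚ) : Set where
  constructor mkUniform₂
  field
    modulus₂ : ∀ ε → 0ℚ < ε → ∃ λ ((δ , _) : ℚ⁺) →
      ∀ p q r s → dist p r < δ → dist q s < δ → dist (p ∙ q) (r ∙ s) < ε
open UniformlyContinuous₂

+-uniform : UniformlyContinuous₂ _+_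
+-uniform = mkUniform₂ λ ε 0<ε → (½ * ε , half⁺ 0<ε) , λ p q r s d₁ d₂ → ℚₚ.≤-<-trans
  (subst (ℚ._≤ dist p r + dist q s)
    (cong ℚ.∣_∣ (solve 4 (λ a b c d → (a :- c) :+ (b :- d) := (a :+ b) :- (c :+ d)) refl p q r s))
    (ℚₚ.∣p+q∣≤∣p∣+∣q∣ (p - r) (q - s)))
  (subst (dist p r + dist q s <_) (half+half≡ ε) (ℚₚ.+-mono-< d₁ d₂))
  where open +-*-Solver

minus-uniform : UniformlyContinuous₂ _-_
minus-uniform = mkUniform₂ λ ε 0<ε →
  let δ , close = modulus₂ +-uniform ε 0<ε
  in δ , λ p q r s d₁ d₂ → close p (- q) r (- s) d₁
    (subst (_< proj₁ δ)
      (trans (sym (ℚₚ.∣-p∣≡∣p∣ (q - s))) (cong ℚ.∣_∣ (ℚₚ.neg-distrib-+ q (- s)))) d₂)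

-- The minimum `r ⊓ s` is `r` or `s`, and `p ⊓ q` lies below the partner of whichever it is.
⊓-<-⊓+ε : ∀ {p q r s ε} → p < r + ε → q < s + ε → p ⊓ q < r ⊓ s + ε
⊓-<-⊓+ε {p} {q} {r} {s} {ε} p<r+ε q<s+ε =
  [ (λ eq → subst (λ z → p ⊓ q < z + ε) (sym eq) (ℚₚ.≤-<-trans (ℚₚ.p⊓q≤p p q) p<r+ε))
  , (λ eq → subst (λ z → p ⊓ q < z + ε) (sym eq) (ℚₚ.≤-<-trans (ℚₚ.p⊓q≤q p q) q<s+ε))
  ]′ (ℚₚ.⊓-sel r s)

-- The minimum is 1-Lipschitz for the sup distance, so `ε` is its own modulus; the one-sided bound
-- is used in both directions.
⊓-uniform : UniformlyContinuous₂ _⊓_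
⊓-uniform = mkUniform₂ λ ε 0<ε → (ε , 0<ε) , λ p q r s d₁ d₂ → <⇒dist<
  (⊓-<-⊓+ε {p} {q} {r} {s} (dist<⇒< d₁) (dist<⇒< d₂))
  (⊓-<-⊓+ε {r} {s} {p} {q} (dist<⇒< (subst (_< ε) (dist-comm p r) d₁))
                           (dist<⇒< (subst (_< ε) (dist-comm q s) d₂)))

proj-uniform : ∀ i → UniformlyContinuous {m} (λ a → a i)
proj-uniform i = mkUniform λ ε 0<ε → (ε , 0<ε) , λ _ _ d → d i

const-uniform : ∀ c → UniformlyContinuous {m} (const c)
const-uniform c = mkUniform λ ε 0<ε → 1⁺ , λ _ _ _ → subst (_< ε) (sym (dist-self c)) 0<ε

compose₂-uniform : ∀ {_∙_ : ℚ → ℚ → ℚ} {f g : Vector ℚ m → ℚ} → UniformlyContinuous₂ _∙_ →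
  UniformlyContinuous f → UniformlyContinuous g → UniformlyContinuous (λ a → f a ∙ g a)
compose₂-uniform ∙-unif f-unif g-unif = mkUniform λ ε 0<ε →
  let (δ , 0<δ) , close     = modulus₂ ∙-unif ε 0<ε
      (δ₁ , 0<δ₁) , close₁ = modulus f-unif δ 0<δ
      (δ₂ , 0<δ₂) , close₂ = modulus g-unif δ 0<δ
  in (δ₁ , 0<δ₁) ⊓⁺ (δ₂ , 0<δ₂) , λ a b d → close _ _ _ _
       (close₁ a b λ i → ℚₚ.<-≤-trans (d i) (ℚₚ.p⊓q≤p δ₁ δ₂))
       (close₂ a b λ i → ℚₚ.<-≤-trans (d i) (ℚₚ.p⊓q≤q δ₁ δ₂))

sum-uniform : ∀ {n} {f : Fin n → Vector ℚ m → ℚ} →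
  (∀ v → UniformlyContinuous (f v)) → UniformlyContinuous λ a → sum λ v → f v a
sum-uniform {n = zero}  h = const-uniform 0ℚ
sum-uniform {n = suc n} h = compose₂-uniform +-uniform (h zero) (sum-uniform (h ∘ suc))

-- Point masses and finite sums

pointMass : Fin n → ℚ → Vector ℚ n
pointMass e c = updateAt (const 0ℚ) e (const c)

pointMass-uniform : ∀ (e v : Fin n) {f : Vector ℚ m → ℚ} →
  UniformlyContinuous f → UniformlyContinuous λ a → pointMass e (f a) v
pointMass-uniform zero    zero    h = h
pointMass-uniform zero    (suc v) h = const-uniform 0ℚ
pointMass-uniform (suc e) zero    h = const-uniform 0ℚ
pointMass-uniform (suc e) (suc v) h = pointMass-uniform e v h

pointMass-≥0 : ∀ (e : Fin n) {c} → 0ℚ ℚ.≤ c → ∀ v → 0ℚ ℚ.≤ pointMass e c v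
pointMass-≥0 zero    0≤c zero    = 0≤c
pointMass-≥0 zero    0≤c (suc v) = ℚₚ.≤-refl
pointMass-≥0 (suc e) 0≤c zero    = ℚₚ.≤-refl
pointMass-≥0 (suc e) 0≤c (suc v) = pointMass-≥0 e 0≤c v

pointMass-0 : ∀ (e v : Fin n) → pointMass e 0ℚ v ≡ 0ℚ
pointMass-0 zero    zero    = refl
pointMass-0 zero    (suc v) = refl
pointMass-0 (suc e) zero    = refl
pointMass-0 (suc e) (suc v) = pointMass-0 e v

sum-0 : ∀ n → sum {n} (const 0ℚ) ≡ 0ℚ
sum-0 zero    = refl
sum-0 (suc n) = trans (ℚₚ.+-identityˡ _) (sum-0 n)

sum-pointMass : ∀ (e : Fin n) c → sum (pointMass e c) ≡ c
sum-pointMass {suc n} zero    c = trans (cong (c +_) (sum-0 n)) (ℚₚ.+-identityʳ c)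
sum-pointMass {suc n} (suc e) c = trans (ℚₚ.+-identityˡ _) (sum-pointMass e c)

sum-≥0 : ∀ {n} {a : Vector ℚ n} → (∀ v → 0ℚ ℚ.≤ a v) → 0ℚ ℚ.≤ sum a
sum-≥0 {zero}  h = ℚₚ.≤-refl
sum-≥0 {suc n} h = ℚₚ.+-mono-≤ (h zero) (sum-≥0 (h ∘ suc))

-- Serves to show that by a time equal to the total mass every coordinate has been emptied.
coordinate≤sum : ∀ {a : Vector ℚ n} → (∀ v → 0ℚ ℚ.≤ a v) → ∀ v → a v ℚ.≤ sum a
coordinate≤sum {a = a} h zero    = subst (ℚ._≤ sum a) (ℚₚ.+-identityʳ _)
  (ℚₚ.+-monoʳ-≤ (a zero) (sum-≥0 (h ∘ suc)))
coordinate≤sum {a = a} h (suc v) = ℚₚ.≤-trans (coordinate≤sum (h ∘ suc) v)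
  (subst (ℚ._≤ sum a) (ℚₚ.+-identityˡ _) (ℚₚ.+-monoˡ-≤ (sum (a ∘ suc)) (h zero)))

-- Extension of uniformly continuous functions to ℝ

_⟨_⟩ : Vector ℝ m → ℕ → Vector ℚ m
(x ⟨ k ⟩) i = seq (x i) k

-- The image sequence is Cauchy from the index past which every coordinate varies by less than the
-- `δ` that the modulus assigns to `ε`.
lift : {f : Vector ℚ m → ℚ} → UniformlyContinuous f → Vector ℝ m → ℝ
lift {f = f} f-unif x = mkℝ (λ k → f (x ⟨ k ⟩)) λ ε 0<ε →
  let (δ , 0<δ) , close = modulus f-unif ε 0<ε
      N , p = common-witness _⊔_ 0
        (λ {_} {M} {N} p j k ≤j ≤k → p j k (ℕₚ.m⊔n≤o⇒m≤o M N ≤j) (ℕₚ.m⊔n≤o⇒m≤o M N ≤k))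
        (λ {_} {M} {N} p j k ≤j ≤k → p j k (ℕₚ.m⊔n≤o⇒n≤o M N ≤j) (ℕₚ.m⊔n≤o⇒n≤o M N ≤k))
        (λ i → cauchy (x i) δ 0<δ)
  in N , λ j k ≤j ≤k → close (x ⟨ j ⟩) (x ⟨ k ⟩) λ i → p i j k ≤j ≤k

lift-cong : {f : Vector ℚ m → ℚ} (f-unif : UniformlyContinuous f) (x y : Vector ℝ m) →
  (∀ i → x i ≈ᴿ y i) → lift f-unif x ≈ᴿ lift f-unif y
lift-cong f-unif x y x≈y ε 0<ε =
  let (δ , 0<δ) , close = modulus f-unif ε 0<ε
  in eventually-map (λ k → close (x ⟨ k ⟩) (y ⟨ k ⟩)) (eventually-∀ λ i → x≈y i δ 0<δ)

-- Open balls in ℝ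

Ball : ℝ → ℚ → Pred ℝ 0ℓ
Ball x ε y = ∣ y -ᴿ x ∣ᴿ <ᴿ fromℚ ε

Ball⇒dist< : ∀ {x y δ} → Ball x δ y → Eventually λ k → dist (seq y k) (seq x k) < δ
Ball⇒dist< (η , 0<η , near) =
  eventually-map (λ k ≤δ → ℚₚ.<-≤-trans (p<p+ε _ 0<η) ≤δ) near

dist<⇒Ball : ∀ {x y ε} → 0ℚ < ε →
  (Eventually λ k → dist (seq y k) (seq x k) < ½ * ε) → Ball x ε y
dist<⇒Ball {ε = ε} 0<ε near = ½ * ε , half⁺ 0<ε , eventually-map
  (λ k d → ℚₚ.≤-trans (ℚₚ.+-monoˡ-≤ (½ * ε) (ℚₚ.<⇒≤ d)) (ℚₚ.≤-reflexive (half+half≡ ε))) near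

Ball-center : ∀ x {ε} → 0ℚ < ε → Ball x ε x
Ball-center x 0<ε = dist<⇒Ball {x} {x} 0<ε (≈ᴿ-refl {x} _ (half⁺ 0<ε))

Ball-mono : ∀ {x y δ ε} → δ ℚ.≤ ε → Ball x δ y → Ball x ε y
Ball-mono δ≤ε (η , 0<η , near) = η , 0<η , eventually-map (λ k ≤δ → ℚₚ.≤-trans ≤δ δ≤ε) near

Ball-open : ∀ x ε → RealOpen (Ball x ε)
-- The gap `η` by which `y` lies inside the ball is a radius around `y` that stays inside, by the
-- triangle inequality.
Ball-open x ε = record { ball = λ {y} (η , 0<η , N , near) → η , 0<η ,
  λ {z} (ζ , 0<ζ , M , near′) → ζ , 0<ζ , M ⊔ N , λ k ≤k →
    let a = seq x k
        b = seq y k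
        c = seq z k
        open ℚₚ.≤-Reasoning
        open +-*-Solver
    in begin
      dist c a + ζ                ≤⟨ ℚₚ.+-monoˡ-≤ ζ (dist-through c b a) ⟩
      (dist c b + dist b a) + ζ   ≡⟨ solve 3 (λ p q r → (p :+ q) :+ r := q :+ (p :+ r)) refl (dist c b) (dist b a) ζ ⟩
      dist b a + (dist c b + ζ)   ≤⟨ ℚₚ.+-monoʳ-≤ (dist b a) (near′ k (ℕₚ.m⊔n≤o⇒m≤o M N ≤k)) ⟩
      dist b a + η                ≤⟨ near k (ℕₚ.m⊔n≤o⇒n≤o M N ≤k) ⟩
      ε                           ∎ }

-- The modulus is taken at `½ * ε` to leave the gap that membership in a ball of radius `ε`
-- requires.
lift-uniform : {f : Vector ℚ m → ℚ} (f-unif : UniformlyContinuous f) → ∀ ε → 0ℚ < ε →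
  ∃ λ ((δ , _) : ℚ⁺) → ∀ (x y : Vector ℝ m) → (∀ i → Ball (x i) δ (y i)) →
  Ball (lift f-unif x) ε (lift f-unif y)
lift-uniform f-unif ε 0<ε =
  let (δ , 0<δ) , close = modulus f-unif (½ * ε) (half⁺ 0<ε)
  in (δ , 0<δ) , λ x y near →
    dist<⇒Ball {lift f-unif x} {lift f-unif y} 0<ε
      (eventually-map (λ k → close (y ⟨ k ⟩) (x ⟨ k ⟩)) (eventually-∀ λ i → Ball⇒dist< {x i} {y i} (near i)))

-- Facts about reals from facts about their terms

termwise-≈ᴿ : ∀ x y → (∀ k → seq x k ≡ seq y k) → x ≈ᴿ y
termwise-≈ᴿ x y x≡y ε 0<ε = 0 , λ k _ → subst (λ q → dist q (seq y k) < ε) (sym (x≡y k))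
  (subst (_< ε) (sym (dist-self (seq y k))) 0<ε)

termwise-≥0 : ∀ x → (∀ k → 0ℚ ℚ.≤ seq x k) → 0ᴿ ≤ᴿ x
termwise-≥0 x h ε 0<ε = 0 , λ k _ → ℚₚ.+-mono-≤ (h k) (ℚₚ.<⇒≤ 0<ε)

≥0-resp-≈ᴿ : ∀ x y → x ≈ᴿ y → (∀ k → 0ℚ ℚ.≤ seq x k) → 0ᴿ ≤ᴿ y
≥0-resp-≈ᴿ x y x≈y h ε 0<ε =
  eventually-map (λ k d → ℚₚ.≤-trans (h k) (ℚₚ.<⇒≤ (dist<⇒< d))) (x≈y ε 0<ε)

squeeze-≈0 : ∀ x y → (∀ k → ℚ.∣ seq x k ∣ ℚ.≤ ℚ.∣ seq y k ∣) → y ≈ᴿ 0ᴿ → x ≈ᴿ 0ᴿ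
squeeze-≈0 x y h y≈0 ε 0<ε = eventually-map
  (λ k d → subst (_< ε) (cong ℚ.∣_∣ (sym (ℚₚ.+-identityʳ (seq x k))))
    (ℚₚ.≤-<-trans (h k) (subst (_< ε) (cong ℚ.∣_∣ (ℚₚ.+-identityʳ (seq y k))) d)))
  (y≈0 ε 0<ε)

≥0⇒∣∣≈ : ∀ x → 0ᴿ ≤ᴿ x → ∣ x ∣ᴿ ≈ᴿ x
≥0⇒∣∣≈ x 0≤x ε 0<ε = eventually-map
  (λ k h → <⇒dist< (bound (seq x k) h) (ℚₚ.≤-<-trans (p≤∣p∣ (seq x k)) (p<p+ε _ 0<ε)))
  -- Terms of a non-negative real may be slightly negative, here at least a quarter of `ε` below
  -- zero at worst. Doubling `0 ≤ p + ½ * η` gives `- p ≤ p + η`, and `η = ½ * ε` leaves room for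
  -- strictness.
  (0≤x (½ * η) (half⁺ (half⁺ 0<ε)))
  where
  η : ℚ
  η = ½ * ε
  bound : ∀ p → 0ℚ ℚ.≤ p + ½ * η → ℚ.∣ p ∣ < p + ε
  bound p h with ℚₚ.∣p∣≡p∨∣p∣≡-p p
  ... | inj₁ eq = subst (_< p + ε) (sym eq) (p<p+ε p 0<ε)
  ... | inj₂ eq = subst (_< p + ε) (sym eq) (begin-strict
    - p                                  ≡⟨ ℚₚ.+-identityˡ (- p) ⟨
    0ℚ - p                               ≤⟨ ℚₚ.+-monoˡ-≤ (- p) (ℚₚ.+-mono-≤ h h) ⟩
    ((p + ½ * η) + (p + ½ * η)) - p      ≡⟨ solve 2 (λ p h → ((p :+ h) :+ (p :+ h)) :- p := p :+ (h :+ h)) refl p (½ * η) ⟩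
    p + (½ * η + ½ * η)                  ≡⟨ cong (p +_) (half+half≡ η) ⟩
    p + η                                <⟨ p<p+ε (p + η) (half⁺ 0<ε) ⟩
    (p + η) + η                          ≡⟨ ℚₚ.+-assoc p η η ⟩
    p + (η + η)                          ≡⟨ cong (p +_) (half+half≡ ε) ⟩
    p + ε                                ∎)
    where
    open ℚₚ.≤-Reasoning
    open +-*-Solver

seq-sumᴿ : ∀ {n} (x : Vector ℝ n) k → seq (sumᴿ x) k ≡ sum (x ⟨ k ⟩)
seq-sumᴿ {zero}  x k = refl
seq-sumᴿ {suc n} x k = cong (seq (x zero) k +_) (seq-sumᴿ (x ∘ suc) k)

lift-∣∣ : {f : Vector ℚ m → ℚ} (f-unif : UniformlyContinuous f) (x : Vector ℝ m) →
  (∀ i → 0ᴿ ≤ᴿ x i) → lift f-unif x ≈ᴿ lift f-unif (∣_∣ᴿ ∘ x)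
lift-∣∣ f-unif x 0≤x = lift-cong f-unif x (∣_∣ᴿ ∘ x) λ i →
  ≈ᴿ-sym {∣ x i ∣ᴿ} {x i} (≥0⇒∣∣≈ (x i) (0≤x i))

-- Term by term, `sumᴿ` is the lift of the rational sum, and lifts respect equality of reals.
sumᴿ-cong : ∀ (x y : Vector ℝ n) → (∀ v → x v ≈ᴿ y v) → sumᴿ x ≈ᴿ sumᴿ y
sumᴿ-cong x y x≈y = begin
  sumᴿ x           ≈⟨ termwise-≈ᴿ (sumᴿ x) (lift sum-unif x) (seq-sumᴿ x) ⟩
  lift sum-unif x  ≈⟨ lift-cong sum-unif x y x≈y ⟩
  lift sum-unif y  ≈⟨ termwise-≈ᴿ (sumᴿ y) (lift sum-unif y) (seq-sumᴿ y) ⟨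
  sumᴿ y           ∎
  where
  open ≈ᴿ-Reasoning
  sum-unif : UniformlyContinuous sum
  sum-unif = sum-uniform proj-uniform

-- The flow towards a vertex, on rational coordinates

-- flow e v (t ∷ p) is coordinate v of the point p at time t: each coordinate
-- sends p v ⊓ t of its mass to e.  Unlike (1 - t) p + t e this needs no product of reals.
flow : Fin n → Fin n → Vector ℚ (suc n) → ℚ
flow e v a = (a (suc v) - a (suc v) ⊓ a zero) + pointMass e (sum λ w → a (suc w) ⊓ a zero) v

flow-uniform : ∀ (e v : Fin n) → UniformlyContinuous (flow e v)
flow-uniform e v = compose₂-uniform +-uniform
  (compose₂-uniform minus-uniform (proj-uniform (suc v)) (sent-uniform v))
  (pointMass-uniform e v (sum-uniform sent-uniform))
  where
  sent-uniform : ∀ w → UniformlyContinuous λ a → a (suc w) ⊓ a zero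
  sent-uniform w = compose₂-uniform ⊓-uniform (proj-uniform (suc w)) (proj-uniform zero)

p≤q⇒0≤q-p : ∀ {p q} → p ℚ.≤ q → 0ℚ ℚ.≤ q - p
p≤q⇒0≤q-p {p} {q} p≤q = subst (ℚ._≤ q - p) (ℚₚ.+-inverseʳ p) (ℚₚ.+-monoˡ-≤ (- p) p≤q)

module _ (e : Fin n) (a : Vector ℚ (suc n)) where

  -- What the coordinates give up is exactly what the point mass at `e` adds.
  sum-flow : sum (λ v → flow e v a) ≡ sum (a ∘ suc)
  sum-flow = begin
    sum (λ v → kept v + pointMass e (sum sent) v)  ≡⟨ ∑-distrib-+ kept (pointMass e (sum sent)) ⟩
    sum kept + sum (pointMass e (sum sent))        ≡⟨ cong (sum kept +_) (sum-pointMass e (sum sent)) ⟩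
    sum kept + sum sent                            ≡⟨ ∑-distrib-+ kept sent ⟨
    sum (λ v → kept v + sent v)                    ≡⟨ sum-cong-≗ (λ v → solve 2 (λ p q → (p :- q) :+ q := p) refl (a (suc v)) (sent v)) ⟩
    sum (a ∘ suc)                                  ∎
    where
    open ≡-Reasoning
    open +-*-Solver
    sent kept : Vector ℚ n
    sent v = a (suc v) ⊓ a zero
    kept v = a (suc v) - sent v

  flow-≥0 : (∀ i → 0ℚ ℚ.≤ a i) → ∀ v → 0ℚ ℚ.≤ flow e v a
  flow-≥0 0≤a v = ℚₚ.+-mono-≤
    (p≤q⇒0≤q-p (ℚₚ.p⊓q≤p (a (suc v)) (a zero)))
    (pointMass-≥0 e (sum-≥0 λ w → ℚₚ.⊓-glb (0≤a (suc w)) (0≤a zero)) v)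

  -- Away from `e` no mass arrives and a non-negative amount leaves. Hence a coordinate that
  -- vanishes keeps vanishing, which controls the support.
  ∣flow∣≤ : (∀ i → 0ℚ ℚ.≤ a i) → ∀ {v} → v ≢ e → ℚ.∣ flow e v a ∣ ℚ.≤ ℚ.∣ a (suc v) ∣
  ∣flow∣≤ 0≤a {v} v≢e = begin
    ℚ.∣ flow e v a ∣                  ≡⟨ ℚₚ.0≤p⇒∣p∣≡p (flow-≥0 0≤a v) ⟩
    flow e v a                        ≡⟨ cong (kept +_) (updateAt-minimal v e (const 0ℚ) v≢e) ⟩
    kept + 0ℚ                         ≡⟨ ℚₚ.+-identityʳ kept ⟩
    a (suc v) - a (suc v) ⊓ a zero    ≤⟨ ℚₚ.+-monoʳ-≤ (a (suc v)) (ℚₚ.neg-antimono-≤ (ℚₚ.⊓-glb (0≤a (suc v)) (0≤a zero))) ⟩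
    a (suc v) + 0ℚ                    ≡⟨ ℚₚ.+-identityʳ (a (suc v)) ⟩
    a (suc v)                         ≤⟨ p≤∣p∣ (a (suc v)) ⟩
    ℚ.∣ a (suc v) ∣                   ∎
    where
    open ℚₚ.≤-Reasoning
    kept : ℚ
    kept = a (suc v) - a (suc v) ⊓ a zero

  -- The minimum of a non-negative coordinate with 0 is 0, so nothing is sent.
  flow-at-0 : a zero ≡ 0ℚ → (∀ v → 0ℚ ℚ.≤ a (suc v)) → ∀ v → flow e v a ≡ a (suc v)
  flow-at-0 t≡0 0≤a v = begin
    (a (suc v) - sent v) + pointMass e (sum sent) v  ≡⟨ cong₂ (λ q s → (a (suc v) - q) + pointMass e s v) (sent≡0 v) (trans (sum-cong-≗ sent≡0) (sum-0 n)) ⟩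
    (a (suc v) - 0ℚ) + pointMass e 0ℚ v              ≡⟨ cong ((a (suc v) - 0ℚ) +_) (pointMass-0 e v) ⟩
    (a (suc v) - 0ℚ) + 0ℚ                            ≡⟨ ℚₚ.+-identityʳ _ ⟩
    a (suc v) - 0ℚ                                   ≡⟨ ℚₚ.+-identityʳ _ ⟩
    a (suc v)                                        ∎
    where
    open ≡-Reasoning
    sent : Vector ℚ n
    sent w = a (suc w) ⊓ a zero
    sent≡0 : ∀ w → sent w ≡ 0ℚ
    sent≡0 w = trans (cong (a (suc w) ⊓_) t≡0) (ℚₚ.p≥q⇒p⊓q≡q (0≤a w))

  -- No coordinate exceeds the total, so each minimum is the whole coordinate and everything is
  -- sent.
  flow-at-sum : a zero ≡ sum (a ∘ suc) → (∀ v → 0ℚ ℚ.≤ a (suc v)) →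
                ∀ v → flow e v a ≡ pointMass e (a zero) v
  flow-at-sum t≡sum 0≤a v = begin
    (a (suc v) - sent v) + pointMass e (sum sent) v       ≡⟨ cong₂ (λ q s → (a (suc v) - q) + pointMass e s v) (sent≡all v) (trans (sum-cong-≗ sent≡all) (sym t≡sum)) ⟩
    (a (suc v) - a (suc v)) + pointMass e (a zero) v      ≡⟨ cong (_+ pointMass e (a zero) v) (ℚₚ.+-inverseʳ (a (suc v))) ⟩
    0ℚ + pointMass e (a zero) v                           ≡⟨ ℚₚ.+-identityˡ _ ⟩
    pointMass e (a zero) v                                ∎
    where
    open ≡-Reasoning
    sent : Vector ℚ n
    sent w = a (suc w) ⊓ a zero
    sent≡all : ∀ w → sent w ≡ a (suc w)
    sent≡all w = ℚₚ.p≤q⇒p⊓q≡p (subst (a (suc w) ℚ.≤_) (sym t≡sum) (coordinate≤sum 0≤a w))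

-- Contraction of a cone to its apex

module Cone (K : SimplicialComplex n) (e : Fin n)
            (cone : ∀ {σ} → SimplicialComplex.Face K σ → SimplicialComplex.Face K (σ ∪ ⁅ e ⁆)) where
  open SimplicialComplex K
  open RealizationPoint
  open UnitIntervalPoint

  apex : RealizationPoint K
  apex = record
    { coord     = λ v → fromℚ (pointMass e 1ℚ v)
    ; coord-≥0  = λ v → termwise-≥0 (fromℚ (pointMass e 1ℚ v))
        λ _ → pointMass-≥0 e (ℚₚ.nonNegative⁻¹ 1ℚ) v
    ; coord-sum = termwise-≈ᴿ (sumᴿ λ v → fromℚ (pointMass e 1ℚ v)) 1ᴿ
        λ k → trans (seq-sumᴿ (λ v → fromℚ (pointMass e 1ℚ v)) k) (sum-pointMass e 1ℚ)
    ; carrier   = ⁅ e ⁆ , Face-vertex e , λ v v∉ →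
        termwise-≈ᴿ (fromℚ (pointMass e 1ℚ v)) 0ᴿ
          λ _ → updateAt-minimal v e (const 0ℚ) (Subsetₚ.x∉⁅y⁆⇒x≢y v∉)
    }

  flowᴿ : Fin n → Vector ℝ (suc n) → ℝ
  flowᴿ v = lift (flow-uniform e v)

  module _ (t : UnitIntervalPoint) (p : RealizationPoint K) where

    timed : Vector ℝ (suc n)
    timed = value t ∷ coord p

    timed-≥0 : ∀ i → 0ᴿ ≤ᴿ timed i
    timed-≥0 zero    = 0≤ t
    timed-≥0 (suc v) = coord-≥0 p v

    flowed : Fin n → ℝ
    flowed v = flowᴿ v timed

    ∣flowed∣ : Fin n → ℝ
    ∣flowed∣ v = flowᴿ v (∣_∣ᴿ ∘ timed)

    flowed≈∣flowed∣ : ∀ v → flowed v ≈ᴿ ∣flowed∣ v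
    flowed≈∣flowed∣ v = lift-∣∣ (flow-uniform e v) timed timed-≥0

    flowed-≥0 : ∀ v → 0ᴿ ≤ᴿ flowed v
    flowed-≥0 v = ≥0-resp-≈ᴿ (∣flowed∣ v) (flowed v)
      (≈ᴿ-sym {flowed v} {∣flowed∣ v} (flowed≈∣flowed∣ v))
      λ k → flow-≥0 e ((∣_∣ᴿ ∘ timed) ⟨ k ⟩) (λ i → ℚₚ.0≤∣p∣ (seq (timed i) k)) v

    flowed-sum : sumᴿ flowed ≈ᴿ 1ᴿ
    flowed-sum = begin
      sumᴿ flowed     ≈⟨ termwise-≈ᴿ (sumᴿ flowed) (sumᴿ (coord p)) (λ k →
                           trans (seq-sumᴿ flowed k)
                             (trans (sum-flow e (timed ⟨ k ⟩)) (sym (seq-sumᴿ (coord p) k)))) ⟩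
      sumᴿ (coord p)  ≈⟨ coord-sum p ⟩
      1ᴿ              ∎
      where open ≈ᴿ-Reasoning

    -- The bound `∣flow∣≤` asks for non-negative terms, so it is applied after passing to absolute
    -- values.
    flowed-support : ∀ v → v ≢ e → coord p v ≈ᴿ 0ᴿ → flowed v ≈ᴿ 0ᴿ
    flowed-support v v≢e p≈0 = begin
      flowed v    ≈⟨ flowed≈∣flowed∣ v ⟩
      ∣flowed∣ v  ≈⟨ squeeze-≈0 (∣flowed∣ v) ∣ coord p v ∣ᴿ
                       (λ k → ∣flow∣≤ e ((∣_∣ᴿ ∘ timed) ⟨ k ⟩) (λ i → ℚₚ.0≤∣p∣ (seq (timed i) k)) v≢e)
                       (squeeze-≈0 ∣ coord p v ∣ᴿ (coord p v)
                         (λ k → ℚₚ.≤-reflexive (ℚₚ.∣∣p∣∣≡∣p∣ (seq (coord p v) k))) p≈0) ⟩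
      0ᴿ          ∎
      where open ≈ᴿ-Reasoning

    contract : RealizationPoint K
    contract = record
      { coord     = flowed
      ; coord-≥0  = flowed-≥0
      ; coord-sum = flowed-sum
      ; carrier   =
          let σ , σ-face , zero-off-σ = carrier p
          -- Only `e` can gain mass, so the support grows by at most `e`, and `cone` keeps the
          -- enlarged carrier a face.
          in σ ∪ ⁅ e ⁆ , cone σ-face , λ v v∉ → flowed-support v
               (Subsetₚ.x∉⁅y⁆⇒x≢y (v∉ ∘ Subsetₚ.x∈p∪q⁺ ∘ inj₂))
               (zero-off-σ v (v∉ ∘ Subsetₚ.x∈p∪q⁺ ∘ inj₁))
      }

  contract-at-0 : ∀ p v → flowed 0ᴵ p v ≈ᴿ coord p v
  contract-at-0 p v = begin
    flowed 0ᴵ p v    ≈⟨ flowed≈∣flowed∣ 0ᴵ p v ⟩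
    -- The time has constant terms 0, also after taking absolute values, so `refl` proves the time
    -- hypothesis of `flow-at-0`.
    ∣flowed∣ 0ᴵ p v  ≈⟨ termwise-≈ᴿ (∣flowed∣ 0ᴵ p v) ∣ coord p v ∣ᴿ (λ k →
                          flow-at-0 e ((∣_∣ᴿ ∘ timed 0ᴵ p) ⟨ k ⟩) refl (λ w → ℚₚ.0≤∣p∣ (seq (coord p w) k)) v) ⟩
    ∣ coord p v ∣ᴿ   ≈⟨ ≥0⇒∣∣≈ (coord p v) (coord-≥0 p v) ⟩
    coord p v        ∎
    where open ≈ᴿ-Reasoning

  -- Time 1 is ≈ᴿ the total mass, by which time every coordinate has sent all of its mass.
  contract-at-1 : ∀ p v → flowed 1ᴵ p v ≈ᴿ coord apex v
  contract-at-1 p v = begin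
    flowed 1ᴵ p v                    ≈⟨ lift-cong (flow-uniform e v) (timed 1ᴵ p) (total ∷ x) (λ where
                                          zero    → ≈ᴿ-sym {total} {1ᴿ} total≈1
                                          (suc w) → ≈ᴿ-sym {x w} {coord p w} (x≈p w)) ⟩
    flowᴿ v (total ∷ x)              ≈⟨ termwise-≈ᴿ (flowᴿ v (total ∷ x)) (lift mass-uniform (const total)) (λ k →
                                          flow-at-sum e ((total ∷ x) ⟨ k ⟩) (seq-sumᴿ x k) (λ w → ℚₚ.0≤∣p∣ (seq (coord p w) k)) v) ⟩
    -- A point mass depends uniformly continuously on its weight, so `total≈1` passes through it.
    lift mass-uniform (const total)  ≈⟨ lift-cong mass-uniform (const total) (const 1ᴿ) (λ _ → total≈1) ⟩
    lift mass-uniform (const 1ᴿ)     ≈⟨ termwise-≈ᴿ (lift mass-uniform (const 1ᴿ)) (coord apex v) (λ _ → refl) ⟩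
    coord apex v                     ∎
    where
    open ≈ᴿ-Reasoning

    x : Vector ℝ n
    x w = ∣ coord p w ∣ᴿ

    x≈p : ∀ w → x w ≈ᴿ coord p w
    x≈p w = ≥0⇒∣∣≈ (coord p w) (coord-≥0 p w)

    total : ℝ
    total = sumᴿ x

    total≈1 : total ≈ᴿ 1ᴿ
    total≈1 = begin
      total           ≈⟨ sumᴿ-cong x (coord p) x≈p ⟩
      sumᴿ (coord p)  ≈⟨ coord-sum p ⟩
      1ᴿ              ∎

    mass-uniform : UniformlyContinuous {1} λ a → pointMass e (a zero) v
    mass-uniform = pointMass-uniform e v (proj-uniform zero)

  -- Continuity at `(t , p)` against a basic neighbourhood: each coordinate has its own radius, and
  -- the least of these finitely many radii works for all.
  flowed-near : ∀ t p (B : Fin n → Pred ℝ 0ℓ) → (∀ v → RealOpen (B v)) →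
    (∀ v → B v (flowed t p v)) → ∃ λ ((δ , _) : ℚ⁺) →
    ∀ s q → Ball (value t) δ (value s) → (∀ w → Ball (coord p w) δ (coord q w)) →
    ∀ v → B v (flowed s q v)
  flowed-near t p B B-open centre∈B =
    let δ , near = common-witness _⊓⁺_ 1⁺ {Near}
          (λ {_} {(δ , _)} {(ε , _)} h y d → h y λ i →
            Ball-mono {timed t p i} {y i} (ℚₚ.p⊓q≤p δ ε) (d i))
          (λ {_} {(δ , _)} {(ε , _)} h y d → h y λ i →
            Ball-mono {timed t p i} {y i} (ℚₚ.p⊓q≤q δ ε) (d i))
          λ v → let ε , 0<ε , ball⊆B = RealOpen.ball (B-open v) (centre∈B v)
                    δ , near = lift-uniform (flow-uniform e v) ε 0<ε
                in δ , λ y d → ball⊆B {flowᴿ v y} (near (timed t p) y d)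
    in δ , λ s q s-near q-near v → near v (timed s q) λ where
         zero    → s-near
         (suc w) → q-near w
    where
    Near : Fin n → ℚ⁺ → Set
    Near v (δ , _) = ∀ y → (∀ i → Ball (timed t p i) δ (y i)) → B v (flowᴿ v y)

  contraction : ContinuousMap (UnitInterval ×ˢ ∣ K ∣) ∣ K ∣
  contraction = record
    { to         = λ (t , p) → contract t p
    ; to-cong    = λ {(t , p)} {(s , q)} (t≈s , p≈q) v →
        lift-cong (flow-uniform e v) (timed t p) (timed s q) λ where
          zero    → t≈s
          (suc w) → p≈q w
    ; continuous = λ (W , W-open , V⊆W , W⊆V) → record { box = λ {t} {p} tp∈V →
        let B , B-open , centre∈B , B⊆W = PowerOpen.box W-open (V⊆W tp∈V)
            (δ , 0<δ) , near = flowed-near t p B B-open centre∈B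
        -- The box is the interval of radius `δ` around `t` times the cube of radius `δ` around `p`,
        -- each the trace of an open set of the ambient space.
        in Ball (value t) δ ∘ value ,
           (λ q → ∀ w → Ball (coord p w) δ (coord q w)) ,
           (Ball (value t) δ , Ball-open (value t) δ , (λ b → b) , (λ b → b)) ,
           ((λ y → ∀ w → Ball (coord p w) δ (y w)) ,
             record { box = λ b → (λ w → Ball (coord p w) δ) ,
                                  (λ w → Ball-open (coord p w) δ) , b , λ c → c } ,
             (λ b → b) , (λ b → b)) ,
           Ball-center (value t) 0<δ ,
           (λ w → Ball-center (coord p w) 0<δ) ,
           λ {(s , q)} (s-near , q-near) → W⊆V (B⊆W (near s q s-near q-near)) }
    }

  contractible : Contractible ∣ K ∣
  contractible = apex , record
    { map     = contraction
    ; map-at0 = contract-at-0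
    ; map-at1 = contract-at-1
    }

-- Adding an edge to a 2-matching

module _ (G : SimpleGraph) where
  open SimpleGraph G

  ∈-incident⁻ : ∀ {v e} → e ∈ incident v → v ∈ ends e
  ∈-incident⁻ {v} {e} e∈ = Vecₚ.lookup⇒[]= v (ends e)
    (trans (sym (Vecₚ.lookup∘tabulate _ e)) (Vecₚ.[]=⇒lookup e∈))

  -- The inclusion is asked only of edges at `v`, so that it can compare `H ∪ ⁅ e ⁆` with `H` at a
  -- vertex off `e`.
  degreeIn-mono : ∀ {H H′ v} → H ∩ incident v ⊆ H′ → degreeIn H v ≤ degreeIn H′ v
  degreeIn-mono {H} {H′} {v} sub = Subsetₚ.p⊆q⇒∣p∣≤∣q∣ λ f∈ →
    Subsetₚ.x∈p∩q⁺ (sub f∈ , proj₂ (Subsetₚ.x∈p∩q⁻ H (incident v) f∈))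

  insert-2matching : ∀ {H} e → (∀ v → v ∈ ends e → degree v ≤ 2) →
                     Is2Matching H → Is2Matching (H ∪ ⁅ e ⁆)
  insert-2matching {H} e small H-matching v with v Subsetₚ.∈? ends e
  ... | yes v∈e = ℕₚ.≤-trans (degreeIn-mono {H ∪ ⁅ e ⁆} λ _ → Subsetₚ.∈⊤) (small v v∈e)
  ... | no  v∉e = ℕₚ.≤-trans (degreeIn-mono {H ∪ ⁅ e ⁆} in-H) (H-matching v)
    where
    in-H : (H ∪ ⁅ e ⁆) ∩ incident v ⊆ H
    in-H {f} f∈ with Subsetₚ.x∈p∩q⁻ (H ∪ ⁅ e ⁆) (incident v) f∈
    ... | f∈∪ , f∈v with Subsetₚ.x∈p∪q⁻ H ⁅ e ⁆ f∈∪
    ...   | inj₁ f∈H = f∈H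
    ...   | inj₂ f∈e = ⊥-elim (v∉e (subst (λ g → v ∈ ends g) (Subsetₚ.x∈⁅y⁆⇒x≡y e f∈e) (∈-incident⁻ f∈v)))

mainTheorem6 : (G : SimpleGraph) (e : SimpleGraph.Edge G) (x y : SimpleGraph.Vertex G) →
    SimpleGraph.ends G e ≡ ⁅ x ⁆ ∪ ⁅ y ⁆ →
    SimpleGraph.degree G x ≤ 2 → SimpleGraph.degree G y ≤ 2 →
    Contractible ∣ M₂ G ∣
mainTheorem6 G e x y ends≡ deg-x deg-y =
  Cone.contractible (M₂ G) e λ {H} → insert-2matching G {H} e small
  where
  open SimpleGraph G
  small : ∀ v → v ∈ ends e → degree v ≤ 2
  small v v∈e with Subsetₚ.x∈p∪q⁻ ⁅ x ⁆ ⁅ y ⁆ (subst (v ∈_) ends≡ v∈e)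
  ... | inj₁ v∈x = subst (λ u → degree u ≤ 2) (sym (Subsetₚ.x∈⁅y⁆⇒x≡y x v∈x)) deg-x
  ... | inj₂ v∈y = subst (λ u → degree u ≤ 2) (sym (Subsetₚ.x∈⁅y⁆⇒x≡y y v∈y)) deg-y
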